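{- Let $\kappa$ be inaccessible and let $b,h:\kappa\to\kappa$ be increasing functions with $h\leq b$, each $b(\alpha)$ an infinite cardinal and each $h(\alpha)$ a cardinal with $h(\alpha)\geq2$. For each cardinal $\lambda<\kappa$ define $$D_\lambda=\{\alpha\in\kappa\mid b(\alpha)\leq\lambda\}\cup\{\alpha\in\kappa\mid h(\alpha)=b(\alpha)\text{ and }\mathrm{cf}(b(\alpha))\leq\lambda\}.$$ (i) If there exists a least cardinal $\lambda<\kappa$ such that $D_\lambda$ is cofinal in $\kappa$, then $\mathfrak b_\kappa^{b,h}(\not\ni^\infty)=\lambda$. (ii) If $D_\lambda$ is bounded in $\kappa$ for all $\lambda<\kappa$ and there is a stationary set $S\subseteq\kappa$ such that (a) $b$ is continuous on $S$, or (b) for each $\xi\in S$ there exists $\alpha_\xi\geq\xi$ with $h(\alpha_\xi)=b(\alpha_\xi)$ and $\mathrm{cf}(b(\alpha_\xi))\leq\xi$, then $\mathfrak b_\kappa^{b,h}(\not\ni^\infty)=\kappa$. (iii) If $D_\lambda$ is bounded in $\kappa$ for all $\lambda<\kappa$ and there is a club set $C\subseteq\kappa$ such that (a) $b$ is discontinuous on $C$, and (b) for each $\xi\in C$ and $\alpha\geq\xi$, if $h(\alpha)=b(\alpha)$, then $\mathrm{cf}(b(\alpha))>\xi$, then $\kappa^+\leq\mathfrak b_\kappa^{b,h}(\not\ni^\infty)$.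
   Context: "Increasing" means not necessarily strictly increasing. An increasing function $b:\kappa\to\mathrm{Ord}$ is continuous (resp. discontinuous) on $A\subseteq\kappa$ if $b(\gamma)=\bigcup_{\alpha<\gamma}b(\alpha)$ (resp. $b(\gamma)>\bigcup_{\alpha<\gamma}b(\alpha)$) for every limit ordinal $\gamma\in A$. $\prod b$ is the set of functions $f$ with domain $\kappa$ and $f(\alpha)\in b(\alpha)$ for all $\alpha$. $\mathrm{Loc}_\kappa^{b,h}$ is the set of functions $\phi$ with domain $\kappa$ such that $\phi(\alpha)\subseteq b(\alpha)$ and $|\phi(\alpha)|<h(\alpha)$ for all $\alpha$. $f\in^\infty\phi$ (equivalently $\phi\ni^\infty f$) means that for every $\beta<\kappa$ there is $\alpha>\beta$ with $f(\alpha)\in\phi(\alpha)$. The antilocalisation cardinal $\mathfrak b_\kappa^{b,h}(\not\ni^\infty)$ is the least size of a set $\Phi\subseteq\mathrm{Loc}_\kappa^{b,h}$ such that for every $f\in\prod b$ there is $\phi\in\Phi$ with $f\in^\infty\phi$. -}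

module Defs where

open import Data.Nat.Base using (ℕ)
open import Data.Product using (Σ; ∃; _×_; _,_; proj₁; proj₂)
open import Data.Sum.Base using (_⊎_)
open import Function.Bundles using (Injection; Bijection)
open import Induction.WellFounded using (WellFounded)
open import Level using (Level; _⊔_; suc)
open import Relation.Binary.Bundles using (Setoid)
import Relation.Binary.Construct.On as On
import Relation.Binary.Construct.StrictToNonStrict as NonStrict
open import Relation.Binary.Core using (Rel)
open import Relation.Binary.Definitions using (Monotonic₁)
open import Relation.Binary.Indexed.Heterogeneous.Construct.Trivial using (indexedSetoid)
open import Relation.Binary.PropositionalEquality using (_≡_; setoid)
open import Relation.Binary.Structures using (IsStrictTotalOrder)
open import Relation.Nullary using (¬_)
open import Relation.Unary using (Pred; _∈_; _⊆_; _≐_)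
open import Relation.Unary.Relation.Binary.Equality using (≐-setoid)
open import Function.Indexed.Relation.Binary.Equality using (≡-setoid)

private
  variable
    a b a₁ a₂ b₁ b₂ p : Level

-- Types play the role of sets.  The ambient theory ZFC is matched by assuming
-- excluded middle (for types, so that it also yields choice functions) together
-- with function extensionality wherever classical reasoning is intended.

-- Sizes.  A "set" is a setoid; a subset of a setoid is a predicate, and its
-- elements are compared by their first components only, so that proofs of
-- membership do not count.  Sizes are compared by injections.

infix 4 _≼_ _≺_ _≃_

_≼_ : Setoid a₁ a₂ → Setoid b₁ b₂ → Set (a₁ ⊔ a₂ ⊔ b₁ ⊔ b₂)
A ≼ B = Injection A B

_≺_ : Setoid a₁ a₂ → Setoid b₁ b₂ → Set (a₁ ⊔ a₂ ⊔ b₁ ⊔ b₂)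
A ≺ B = A ≼ B × ¬ (B ≼ A)

_≃_ : Setoid a₁ a₂ → Setoid b₁ b₂ → Set (a₁ ⊔ a₂ ⊔ b₁ ⊔ b₂)
A ≃ B = Bijection A B

subset : (A : Setoid a b) → Pred (Setoid.Carrier A) p → Setoid (a ⊔ p) b
subset A X = On.setoid A (proj₁ {B = X})

∣_∣ : {A : Set a} → Pred A p → Setoid (a ⊔ p) a
∣ X ∣ = subset (setoid _) X

𝒫 : ∀ {ℓ} {A : Set ℓ} → Pred A ℓ → Setoid (suc ℓ) ℓ
𝒫 {ℓ} {A} X = subset (≐-setoid A ℓ) (λ Y → Y ⊆ X)

-- An ordinal is a well-ordered type.  Its elements play the role of the
-- smaller ordinals, the element α standing for the initial segment ↓ α.

record Ordinal ℓ : Set (suc ℓ) where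
  infix 4 _<_
  field
    Carrier            : Set ℓ
    _<_                : Rel Carrier ℓ
    isStrictTotalOrder : IsStrictTotalOrder _≡_ _<_
    wellFounded        : WellFounded _<_

  open NonStrict _≡_ _<_ public using (_≤_)

  ↓ : Carrier → Pred Carrier ℓ
  ↓ α β = β < α

  whole : Setoid ℓ ℓ
  whole = setoid Carrier

  -- α is an initial ordinal (finite ones included).
  IsCardinal : Pred Carrier ℓ
  IsCardinal α = ∀ β → β < α → ¬ (∣ ↓ α ∣ ≼ ∣ ↓ β ∣)

  IsInfiniteCardinal : Pred Carrier ℓ
  IsInfiniteCardinal α = IsCardinal α × setoid ℕ ≼ ∣ ↓ α ∣

  CofinalBelow : Carrier → Pred (Pred Carrier ℓ) ℓ
  CofinalBelow δ X = X ⊆ ↓ δ × (∀ β → β < δ → ∃ λ γ → γ ∈ X × β ≤ γ)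

  -- cf(δ) is the least size of a cofinal subset of δ; Cf δ μ reads "cf(δ) = μ".
  Cf : Carrier → Carrier → Set (suc ℓ)
  Cf δ μ = IsCardinal μ
    × (∃ λ X → CofinalBelow δ X × ∣ X ∣ ≃ ∣ ↓ μ ∣)
    × (∀ X → CofinalBelow δ X → ∣ ↓ μ ∣ ≼ ∣ X ∣)

  Cofinal : Pred (Pred Carrier p) (ℓ ⊔ p)
  Cofinal X = ∀ β → ∃ λ γ → γ ∈ X × β ≤ γ

  Bounded : Pred (Pred Carrier p) (ℓ ⊔ p)
  Bounded X = ∃ λ β → X ⊆ ↓ β

  -- Zero is not a limit.
  IsLimit : Pred Carrier ℓ
  IsLimit γ = (∃ λ β → β < γ) × (∀ β → β < γ → ∃ λ δ → β < δ × δ < γ)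

  IsClub : Pred (Pred Carrier ℓ) ℓ
  IsClub C = Cofinal C
    × (∀ γ → IsLimit γ → (∀ β → β < γ → ∃ λ δ → δ ∈ C × β ≤ δ × δ < γ) → γ ∈ C)

  IsStationary : Pred (Pred Carrier ℓ) (suc ℓ)
  IsStationary S = ∀ C → IsClub C → ∃ λ γ → γ ∈ S × γ ∈ C

  Increasing : Pred (Carrier → Carrier) ℓ
  Increasing = Monotonic₁ _≤_ _≤_

  ⋃below : (Carrier → Carrier) → Carrier → Pred Carrier ℓ
  ⋃below f γ β = ∃ λ α → α < γ × β < f α

  ContinuousOn : Pred Carrier ℓ → Pred (Carrier → Carrier) ℓ
  ContinuousOn A f = ∀ γ → γ ∈ A → IsLimit γ → ↓ (f γ) ≐ ⋃below f γ

  DiscontinuousOn : Pred Carrier ℓ → Pred (Carrier → Carrier) ℓ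
  DiscontinuousOn A f =
    ∀ γ → γ ∈ A → IsLimit γ → ∃ λ σ → ↓ σ ≐ ⋃below f γ × σ < f γ

module _ {ℓ} (κ : Ordinal ℓ) where
  open Ordinal κ

  IsInitial : Set ℓ
  IsInitial = ∀ α → ¬ (whole ≼ ∣ ↓ α ∣)

  IsUncountable : Set ℓ
  IsUncountable = ¬ (whole ≼ setoid ℕ)

  IsRegular : Set (suc ℓ)
  IsRegular = ∀ (X : Pred Carrier ℓ) → Cofinal X → whole ≼ ∣ X ∣

  IsStrongLimit : Set (suc ℓ)
  IsStrongLimit = ∀ α → IsCardinal α → 𝒫 (↓ α) ≺ whole

  IsInaccessible : Set (suc ℓ)
  IsInaccessible = IsInitial × IsUncountable × IsRegular × IsStrongLimit

-- IsSuccessorCardinal κ ν reads "ν = κ⁺".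
IsSuccessorCardinal : ∀ {ℓ} → Ordinal ℓ → Ordinal ℓ → Set (suc ℓ)
IsSuccessorCardinal {ℓ} κ ν = IsInitial ν
  × Ordinal.whole κ ≺ Ordinal.whole ν
  × (∀ (μ : Ordinal ℓ) → IsInitial μ → Ordinal.whole κ ≺ Ordinal.whole μ →
       Ordinal.whole ν ≼ Ordinal.whole μ)

module Localisation {ℓ} (κ : Ordinal ℓ)
                    (b h : Ordinal.Carrier κ → Ordinal.Carrier κ) where
  open Ordinal κ

  ∏b : Pred (Carrier → Carrier) ℓ
  ∏b f = ∀ α → f α < b α

  Slalom : Set (suc ℓ)
  Slalom = Carrier → Pred Carrier ℓ

  slalomSetoid : Setoid (suc ℓ) ℓ
  slalomSetoid = ≡-setoid Carrier (indexedSetoid (≐-setoid Carrier ℓ))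

  Loc : Pred Slalom ℓ
  Loc φ = ∀ α → φ α ⊆ ↓ (b α) × ∣ φ α ∣ ≺ ∣ ↓ (h α) ∣

  infix 4 _∈∞_
  _∈∞_ : (Carrier → Carrier) → Slalom → Set ℓ
  f ∈∞ φ = ∀ β → ∃ λ α → β < α × f α ∈ φ α

  IsWitness : Pred (Pred Slalom ℓ) (suc ℓ)
  IsWitness Φ = Φ ⊆ Loc × (∀ f → f ∈ ∏b → ∃ λ φ → φ ∈ Φ × f ∈∞ φ)

  -- The antilocalisation cardinal 𝔟 is the least size of a witness.  As the
  -- sizes are setoids compared by _≼_, it is determined up to _≃_, and it is
  -- described by these two relations: "A ≤ 𝔟" and "𝔟 = A".

  _≤𝔟 : Setoid a₁ a₂ → Set (a₁ ⊔ a₂ ⊔ suc ℓ)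
  A ≤𝔟 = ∀ Φ → IsWitness Φ → A ≼ subset slalomSetoid Φ

  𝔟≃_ : Setoid a₁ a₂ → Set (a₁ ⊔ a₂ ⊔ suc ℓ)
  𝔟≃ A = (∃ λ Φ → IsWitness Φ × subset slalomSetoid Φ ≃ A) × A ≤𝔟

  -- Used only for cardinals λ′ (λ itself is a keyword).
  D : Carrier → Pred Carrier (suc ℓ)
  D λ′ α = b α ≤ λ′ ⊎ (h α ≡ b α × ∃ λ μ → Cf (b α) μ × μ ≤ λ′)

  IsLeastCofinal : Pred Carrier (suc ℓ)
  IsLeastCofinal λ′ = IsCardinal λ′ × Cofinal (D λ′)
    × (∀ μ → IsCardinal μ → Cofinal (D μ) → λ′ ≤ μ)

  AllBounded : Set (suc ℓ)
  AllBounded = ∀ μ → IsCardinal μ → Bounded (D μ)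

{-# OPTIONS --safe #-}
-- An upper bound comes from slaloms whose values at each coordinate α cover
-- b α.  If b α ≤ λ, then λ many singletons do, and if h α = b α and cf (b α) ≤ λ,
-- then λ many initial segments along a cofinal set do; when this happens for
-- cofinally many α, regularity of κ makes one slalom catch a given f.  In (ii)(b)
-- the index of the segment containing f (α_ξ) is below ξ, and pressing down makes
-- it constant; in (ii)(a) pressing down bounds f on an unbounded set, so f is
-- constant on one and caught by a slalom with a constant singleton value.
--
-- For a lower bound, fewer slaloms than claimed are evaded coordinatewise: the
-- union of ν < b α sets of size < h α does not exhaust b α, because their sizes
-- have a common bound τ < b α (by cf (b α) > ν if h α = b α) and ν · τ < b α by
-- Hessenberg's theorem.  For (iii), κ slaloms are evaded diagonally: coordinate
-- α evades those with index below the largest δ ≤ α in a club E ⊆ C of δ with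
-- δ ≤ ⋃ { b β | β < δ }, where discontinuity yields δ < b δ.

module Submission where

open import Defs
open import Axiom.ExcludedMiddle using (ExcludedMiddle)
open import Axiom.Extensionality.Propositional
  using (Extensionality; implicit-extensionality; lower-extensionality)
open import Data.Bool.Properties using (T-irrelevant)
open import Data.Empty.Polymorphic using (⊥)
open import Data.Fin.Base as Fin using (Fin)
import Data.Fin.Properties as Fin
open import Data.Maybe.Base using (Maybe; just; nothing)
open import Data.Maybe.Properties using (just-injective)
open import Data.Nat.Base as ℕ using (ℕ)
import Data.Nat.Induction as ℕ
import Data.Nat.Properties as ℕ
open import Data.Product using (∃; _×_; _,_; proj₁; proj₂)
open import Data.Product.Relation.Binary.Lex.Strict
  using (×-Lex; ×-isStrictTotalOrder; ×-wellFounded)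
open import Data.Sum.Base using (_⊎_; inj₁; inj₂; [_,_]′)
open import Data.Unit.Polymorphic.Base using (⊤)
open import Function.Base using (_∘_; _on_; case_of_)
open import Function.Bundles using (Injection; Bijection)
import Function.Construct.Composition as Composition
import Function.Construct.Identity as Identity
open import Function.Definitions using (Injective)
open import Induction.WellFounded using (WfRec; Acc; acc; module All; module FixPoint)
open import Level using (Level; _⊔_; suc; 0ℓ; Lift; lift; lower)
open import Relation.Binary.Bundles using (Setoid)
import Relation.Binary.Construct.On as On
open import Relation.Binary.Core using (Rel)
open import Relation.Binary.Definitions using (Trichotomous; Tri; tri<; tri≈; tri>)
open import Relation.Binary.PropositionalEquality
  using (_≡_; refl; sym; trans; cong; cong₂; subst; setoid; isEquivalence)
open import Relation.Binary.Structures using (IsStrictTotalOrder)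
open import Relation.Binary.Structures.Biased using (isStrictTotalOrderᶜ)
open import Relation.Nullary using (¬_; Dec; yes; no; contradiction)
open import Relation.Nullary.Decidable
  using (True; toWitness; fromWitness; map′; decidable-stable)
open import Relation.Unary using (Pred; _∈_; _⊆_; _≐_; _⟨×⟩_)

private
  variable
    a₁ a₂ b₁ b₂ c₁ c₂ o p q r : Level

-- Sizes and well-orders

≼-trans : {A : Setoid a₁ a₂} {B : Setoid b₁ b₂} {C : Setoid c₁ c₂} →
          A ≼ B → B ≼ C → A ≼ C
≼-trans = Composition.injection

⊆⇒≼ : {A : Set a₁} {X : Pred A p} {Y : Pred A q} → X ⊆ Y → ∣ X ∣ ≼ ∣ Y ∣
⊆⇒≼ X⊆Y = record
  { to = λ (x , x∈X) → x , X⊆Y x∈X ; cong = λ eq → eq ; injective = λ eq → eq }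

≼-whole : {A : Set a₁} {X : Pred A p} → ∣ X ∣ ≼ setoid A
≼-whole = record { to = proj₁ ; cong = λ eq → eq ; injective = λ eq → eq }

Full : {A : Set a₁} → Pred A a₁
Full _ = ⊤

whole≼Full : {A : Set a₁} → setoid A ≼ ∣ Full {A = A} ∣
whole≼Full = record { to = λ x → x , _ ; cong = λ eq → eq ; injective = λ eq → eq }

⟨×⟩-mono : {A : Set a₁} {A′ : Set a₂} {B : Set b₁} {B′ : Set b₂}
  {X : Pred A p} {X′ : Pred A′ q} {Y : Pred B p} {Y′ : Pred B′ q} →
  ∣ X ∣ ≼ ∣ X′ ∣ → ∣ Y ∣ ≼ ∣ Y′ ∣ → ∣ X ⟨×⟩ Y ∣ ≼ ∣ X′ ⟨×⟩ Y′ ∣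
⟨×⟩-mono f g = record
  { to        = λ ((x , y) , (x∈X , y∈Y)) →
                  (proj₁ (F.to (x , x∈X)) , proj₁ (G.to (y , y∈Y))) ,
                  (proj₂ (F.to (x , x∈X)) , proj₂ (G.to (y , y∈Y)))
  ; cong      = λ eq → cong₂ _,_ (F.cong (cong proj₁ eq)) (G.cong (cong proj₂ eq))
  ; injective = λ eq → cong₂ _,_ (F.injective (cong proj₁ eq)) (G.injective (cong proj₂ eq))
  }
  where module F = Injection f
        module G = Injection g

≺-resp-⊆ : {A : Set a₁} {X : Pred A p} {Y : Pred A q} {B : Setoid b₁ b₂} →
           X ⊆ Y → ∣ Y ∣ ≺ B → ∣ X ∣ ≺ B
≺-resp-⊆ X⊆Y (Y≼B , B⋠Y) =
  ≼-trans (⊆⇒≼ X⊆Y) Y≼B , λ B≼X → B⋠Y (≼-trans B≼X (⊆⇒≼ X⊆Y))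

-- This is how `h α ≥ 2` enters. Uniqueness of elements, not a given element, is assumed, so that
-- empty sets are covered together with singletons.
subsingleton≺ : {A : Set a₁} {X : Pred A p} {B : Setoid b₁ b₂} →
                (∀ {x y} → x ∈ X → y ∈ X → x ≡ y) → setoid (Fin 2) ≼ B → ∣ X ∣ ≺ B
subsingleton≺ {B = B} unique 2≼B =
  record { to        = λ _ → to Fin.zero
         ; cong      = λ _ → Setoid.refl B
         ; injective = λ {(_ , x∈X)} {(_ , y∈X)} _ → unique x∈X y∈X } ,
  λ B≼X → case Injection.injective (≼-trans 2≼B B≼X) {Fin.zero} {Fin.suc Fin.zero}
                 (unique (proj₂ (Injection.to B≼X _)) (proj₂ (Injection.to B≼X _)))
          of λ ()
  where open Injection 2≼B

lower-em : ∀ p {q} → ExcludedMiddle (p ⊔ q) → ExcludedMiddle q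
lower-em p em = map′ lower lift (em {Lift p _})

¬∀⟶∃¬ : {A : Set a₁} {P : A → Set p} → ExcludedMiddle (a₁ ⊔ p) →
        ¬ (∀ x → P x) → ∃ λ x → ¬ P x
¬∀⟶∃¬ {a₁} {p} em ¬∀ = decidable-stable em λ ¬∃ →
  ¬∀ λ x → decidable-stable (lower-em a₁ em) λ ¬px → ¬∃ (x , ¬px)

-- Cantor, Schröder and Bernstein: the elements whose backward orbit ends
-- outside the image of B are mapped forwards, the others are pulled back.
module _ {A : Setoid a₁ a₂} {B : Setoid b₁ b₂}
         (em : ExcludedMiddle (a₁ ⊔ a₂ ⊔ b₁ ⊔ b₂)) (f : A ≼ B) (g : B ≼ A) where
  private
    module A = Setoid A
    module B = Setoid B
    module F = Injection f
    module G = Injection g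

    data Chain : A.Carrier → Set (a₁ ⊔ a₂ ⊔ b₁ ⊔ b₂) where
      base : ∀ {x} → ¬ (∃ λ y → G.to y A.≈ x) → Chain x
      step : ∀ {x z} → Chain x → G.to (F.to x) A.≈ z → Chain z

    Chain-resp : ∀ {x z} → x A.≈ z → Chain x → Chain z
    Chain-resp x≈z (base x∉g)   = base λ (y , gy≈z) → x∉g (y , A.trans gy≈z (A.sym x≈z))
    Chain-resp x≈z (step c w≈x) = step c (A.trans w≈x x≈z)

    preimage : ∀ {x} → ¬ Chain x → ∃ λ y → G.to y A.≈ x
    preimage ¬c = decidable-stable (lower-em (a₁ ⊔ b₂) em) λ x∉g → ¬c (base x∉g)

    choose : ∀ {x} → Dec (Chain x) → B.Carrier
    choose {x} (yes _) = F.to x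
    choose (no ¬c)     = proj₁ (preimage ¬c)

    h : A.Carrier → B.Carrier
    h x = choose (em {Chain x})

    mixed : ∀ {x z} → Chain x → (¬c : ¬ Chain z) → ¬ (F.to x B.≈ proj₁ (preimage ¬c))
    mixed c ¬c eq = ¬c (step c (A.trans (G.cong eq) (proj₂ (preimage ¬c))))

    h-cong : ∀ {x z} → x A.≈ z → h x B.≈ h z
    h-cong {x} {z} x≈z with em {Chain x} | em {Chain z}
    ... | yes _  | yes _  = F.cong x≈z
    ... | yes c  | no ¬c  = contradiction (Chain-resp x≈z c) ¬c
    ... | no ¬c  | yes c  = contradiction (Chain-resp (A.sym x≈z) c) ¬c
    ... | no ¬c  | no ¬c′ = G.injective
      (A.trans (proj₂ (preimage ¬c)) (A.trans x≈z (A.sym (proj₂ (preimage ¬c′)))))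

    h-injective : ∀ {x z} → h x B.≈ h z → x A.≈ z
    h-injective {x} {z} eq with em {Chain x} | em {Chain z}
    ... | yes _  | yes _  = F.injective eq
    ... | yes c  | no ¬c  = contradiction eq (mixed c ¬c)
    ... | no ¬c  | yes c  = contradiction (B.sym eq) (mixed c ¬c)
    ... | no ¬c  | no ¬c′ =
      A.trans (A.sym (proj₂ (preimage ¬c))) (A.trans (G.cong eq) (proj₂ (preimage ¬c′)))

    from : ∀ y → Dec (Chain (G.to y)) → ∃ λ x → h x B.≈ y
    from y (no ¬c) = G.to y , lem
      where
      lem : h (G.to y) B.≈ y
      lem with em {Chain (G.to y)}
      ... | yes c  = contradiction c ¬c
      ... | no ¬c′ = G.injective (proj₂ (preimage ¬c′))
    from y (yes (base ∉g))           = contradiction (y , A.refl) ∉g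
    from y (yes (step {x} c gfx≈gy)) = x , lem
      where
      lem : h x B.≈ y
      lem with em {Chain x}
      ... | yes _  = G.injective gfx≈gy
      ... | no ¬c  = contradiction c ¬c

    h-surjective : ∀ y → ∃ λ x → ∀ {z} → z A.≈ x → h z B.≈ y
    h-surjective y =
      let x , hx≈y = from y em in x , λ z≈x → B.trans (h-cong z≈x) hx≈y

  ≼-antisym : A ≃ B
  ≼-antisym = record { to = h ; cong = h-cong ; bijective = h-injective , h-surjective }

-- Inverse images and lexicographic products come ordered up to a componentwise equality, whereas an
-- `Ordinal` is ordered up to `_≡_`.
strictTotalOrder-≡ : {A : Set a₁} {_≈_ : Rel A a₂} {_<_ : Rel A r} →
  (∀ {x y} → x ≈ y → x ≡ y) →
  IsStrictTotalOrder _≈_ _<_ → IsStrictTotalOrder _≡_ _<_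
strictTotalOrder-≡ {_≈_ = _≈_} {_<_} ≈⇒≡ sto = isStrictTotalOrderᶜ record
  { isEquivalence = isEquivalence ; trans = S.trans ; compare = cmp }
  where
  module S = IsStrictTotalOrder sto
  cmp : Trichotomous _≡_ _<_
  cmp x y with S.compare x y
  ... | tri< x<y x≉y x≯y = tri< x<y (x≉y ∘ S.Eq.reflexive) x≯y
  ... | tri≈ x≮y x≈y x≯y = tri≈ x≮y (≈⇒≡ x≈y) x≯y
  ... | tri> x≮y x≉y x>y = tri> x≮y (x≉y ∘ S.Eq.reflexive) x>y

pullback : (O : Ordinal o) {A : Set o} (f : A → Ordinal.Carrier O) →
           Injective _≡_ _≡_ f → Ordinal o
pullback O {A} f f-inj = record
  { Carrier            = A
  ; _<_                = _<_ on f
  ; isStrictTotalOrder = strictTotalOrder-≡ f-inj (On.isStrictTotalOrder f isStrictTotalOrder)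
  ; wellFounded        = On.wellFounded f wellFounded
  }
  where open Ordinal O

infixr 2 _×ₗₑₓ_

_×ₗₑₓ_ : Ordinal o → Ordinal o → Ordinal o
O ×ₗₑₓ O′ = record
  { Carrier            = O.Carrier × O′.Carrier
  ; _<_                = ×-Lex _≡_ O._<_ O′._<_
  ; isStrictTotalOrder = strictTotalOrder-≡ (λ (x , y) → cong₂ _,_ x y)
      (×-isStrictTotalOrder O.isStrictTotalOrder O′.isStrictTotalOrder)
  ; wellFounded        = ×-wellFounded O.wellFounded O′.wellFounded
  }
  where module O = Ordinal O
        module O′ = Ordinal O′

ω : Ordinal 0ℓ
ω = record { Carrier = ℕ ; _<_ = ℕ._<_
           ; isStrictTotalOrder = ℕ.<-isStrictTotalOrder ; wellFounded = ℕ.<-wellFounded }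

module OrdinalProperties (O : Ordinal o) where
  open Ordinal O
  open IsStrictTotalOrder isStrictTotalOrder public
    using (compare; _<?_) renaming (trans to <-trans; irrefl to <-irrefl)

  <-≤-trans : ∀ {x y z} → x < y → y ≤ z → x < z
  <-≤-trans x<y (inj₁ y<z)  = <-trans x<y y<z
  <-≤-trans x<y (inj₂ refl) = x<y

  ≤-<-trans : ∀ {x y z} → x ≤ y → y < z → x < z
  ≤-<-trans (inj₁ x<y)  y<z = <-trans x<y y<z
  ≤-<-trans (inj₂ refl) y<z = y<z

  ≤-trans : ∀ {x y z} → x ≤ y → y ≤ z → x ≤ z
  ≤-trans (inj₁ x<y)  y≤z = inj₁ (<-≤-trans x<y y≤z)
  ≤-trans (inj₂ refl) y≤z = y≤z

  <⇒≱ : ∀ {x y} → x < y → ¬ (y ≤ x)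
  <⇒≱ x<y y≤x = <-irrefl refl (<-≤-trans x<y y≤x)

  ≰⇒> : ∀ {x y} → ¬ (x ≤ y) → y < x
  ≰⇒> {x} {y} x≰y with compare x y
  ... | tri< x<y _ _ = contradiction (inj₁ x<y) x≰y
  ... | tri≈ _ x≡y _ = contradiction (inj₂ x≡y) x≰y
  ... | tri> _ _ y<x = y<x

  ≮⇒≥ : ∀ {x y} → ¬ (x < y) → y ≤ x
  ≮⇒≥ {x} {y} x≮y with compare x y
  ... | tri< x<y _ _ = contradiction x<y x≮y
  ... | tri≈ _ x≡y _ = inj₂ (sym x≡y)
  ... | tri> _ _ y<x = inj₁ y<x

  ≤-antisym : ∀ {x y} → x ≤ y → y ≤ x → x ≡ y
  ≤-antisym (inj₁ x<y)  y≤x = contradiction y≤x (<⇒≱ x<y)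
  ≤-antisym (inj₂ x≡y)  _   = x≡y

  -- The last component, that the maximum is one of the two, transfers strict bounds on both `x` and
  -- `y` to `z`.
  upperBound : ∀ x y → ∃ λ z → x ≤ z × y ≤ z × (z ≡ x ⊎ z ≡ y)
  upperBound x y with compare x y
  ... | tri< x<y _ _  = y , inj₁ x<y , inj₂ refl , inj₂ refl
  ... | tri≈ _ refl _ = x , inj₂ refl , inj₂ refl , inj₁ refl
  ... | tri> _ _ y<x  = x , inj₂ refl , inj₁ y<x , inj₁ refl

  ↓-mono : ∀ {x y} → x ≤ y → ∣ ↓ x ∣ ≼ ∣ ↓ y ∣
  ↓-mono x≤y = ⊆⇒≼ λ z<x → <-≤-trans z<x x≤y

  least : {P : Pred Carrier p} → ExcludedMiddle (o ⊔ p) →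
          ∃ P → ∃ λ x → P x × (∀ {y} → P y → x ≤ y)
  least {P = P} em (x , px) = go px (wellFounded x)
    where
    go : ∀ {x} → P x → Acc _<_ x → ∃ λ x → P x × (∀ {y} → P y → x ≤ y)
    go {x} px (acc rs) with em {∃ λ y → y < x × P y}
    ... | yes (y , y<x , py) = go py (rs y<x)
    ... | no ¬y = x , px , λ py → ≮⇒≥ λ y<x → ¬y (_ , y<x , py)

  -- Each `x` is sent to its least index. Leastness makes the choice respect `_≈_`, and an index
  -- that determines its element makes it injective.
  index≼ : ExcludedMiddle (o ⊔ p ⊔ r) → (A : Setoid a₁ a₂) (P : Pred Carrier p)
    (R : Setoid.Carrier A → Pred Carrier r) → let open Setoid A in
    (∀ x → ∃ λ ξ → ξ ∈ P × R x ξ) →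
    (∀ {x y ξ} → x ≈ y → R x ξ → R y ξ) →
    (∀ {x y ξ} → R x ξ → R y ξ → x ≈ y) →
    A ≼ ∣ P ∣
  index≼ em A P R total resp functional = record
    { to        = λ x → index x , proj₁ (isIndex x)
    ; cong      = λ {x} {y} x≈y → ≤-antisym
        (minimal x (proj₁ (isIndex y) , resp (sym′ x≈y) (proj₂ (isIndex y))))
        (minimal y (proj₁ (isIndex x) , resp x≈y (proj₂ (isIndex x))))
    ; injective = λ {x} {y} eq → functional (proj₂ (isIndex x))
        (subst (R y) (sym eq) (proj₂ (isIndex y)))
    }
    where
    open Setoid A using () renaming (sym to sym′)
    index : Setoid.Carrier A → Carrier
    index x = proj₁ (least em (total x))
    isIndex : ∀ x → index x ∈ P × R x (index x)
    isIndex x = proj₁ (proj₂ (least em (total x)))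
    minimal : ∀ x {ξ} → ξ ∈ P × R x ξ → index x ≤ ξ
    minimal x = proj₂ (proj₂ (least em (total x)))

  -- List elements of A along O, each time one not listed before, for as long
  -- as there are any.
  module Enumeration (A : Setoid a₁ a₂) (em : ExcludedMiddle (o ⊔ a₁ ⊔ a₂))
                     (ext : Extensionality o (o ⊔ a₁)) where
    open Setoid A using (_≈_) renaming (Carrier to ∣A∣; sym to ≈-sym; trans to ≈-trans)

    module _ (ξ : Carrier) (listed : WfRec _<_ (λ _ → Maybe ∣A∣) ξ) where

      Fresh : Pred ∣A∣ (o ⊔ a₁ ⊔ a₂)
      Fresh x = ∀ {η} (η<ξ : η < ξ) {y} → listed η<ξ ≡ just y → ¬ (y ≈ x)

      pick : Dec (∃ Fresh) → Maybe ∣A∣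
      pick (yes (x , _)) = just x
      pick (no _)        = nothing

      next : Maybe ∣A∣
      next = pick em

    entry : Carrier → Maybe ∣A∣
    entry = All.wfRec wellFounded _ _ next

    -- Function extensionality enters here: `next` receives the earlier entries as a function, and
    -- its value must depend only on the values of that function.
    entry-unfold : ∀ {ξ} → entry ξ ≡ next ξ (λ {η} _ → entry η)
    entry-unfold = FixPoint.unfold-wfRec wellFounded _ next λ ξ eq →
      cong (next ξ) (implicit-extensionality ext
        (lower-extensionality 0ℓ o ext eq))

    entry-spec : ∀ ξ →
      (∃ λ x → entry ξ ≡ just x × Fresh ξ (λ {η} _ → entry η) x) ⊎
      (entry ξ ≡ nothing × ¬ (∃ (Fresh ξ (λ {η} _ → entry η))))
    entry-spec ξ rewrite entry-unfold {ξ} with em {∃ (Fresh ξ (λ {η} _ → entry η))}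
    ... | yes (x , fresh) = inj₁ (x , refl , fresh)
    ... | no none         = inj₂ (refl , none)

    fresh : ∀ {ξ x} → entry ξ ≡ just x → Fresh ξ (λ {η} _ → entry η) x
    fresh {ξ} eq with entry-spec ξ
    ... | inj₁ (_ , eq′ , f) with refl ← trans (sym eq) eq′ = f
    ... | inj₂ (eq′ , _) = case trans (sym eq) eq′ of λ ()

    Lists : ∣A∣ → Pred Carrier (a₁ ⊔ a₂)
    Lists x η = ∃ λ y → entry η ≡ just y × y ≈ x

    exhausted : ∀ {ξ} → entry ξ ≡ nothing → ∀ x → ∃ λ η → η < ξ × Lists x η
    exhausted {ξ} eq x with entry-spec ξ
    ... | inj₁ (_ , eq′ , _) = case trans (sym eq) eq′ of λ ()
    ... | inj₂ (_ , none)    = decidable-stable em λ unlisted →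
      none (x , λ η<ξ {y} eq′ y≈x → unlisted (_ , η<ξ , y , eq′ , y≈x))

    entry-injective : ∀ {ξ η x y} → entry ξ ≡ just x → entry η ≡ just y → x ≈ y → ξ ≡ η
    entry-injective {ξ} {η} eq eq′ x≈y with compare ξ η
    ... | tri< ξ<η _ _ = contradiction x≈y (fresh eq′ ξ<η eq)
    ... | tri≈ _ ξ≡η _ = ξ≡η
    ... | tri> _ _ η<ξ = contradiction (≈-sym x≈y) (fresh eq η<ξ eq′)

  -- Comparability of sizes. Either the listing of `A` never stops on `P`, and then it is an
  -- injection of `P`, or it stops at some `ξ` in `P`, and then all of `A` was listed before `ξ`.
  -- The second case bounds `A` by one proper initial segment, which the later lower bounds rely on.
  enumerate : (A : Setoid a₁ a₂) (P : Pred Carrier p) →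
    ExcludedMiddle (o ⊔ a₁ ⊔ a₂ ⊔ p) → Extensionality o (o ⊔ a₁) →
    ∣ P ∣ ≼ A ⊎ (∃ λ ξ → ξ ∈ P × A ≼ ∣ ↓ ξ ∣)
  enumerate {a₁} {a₂} {p} A P em ext
    with lower-em (a₁ ⊔ a₂) em {∃ λ ξ → ξ ∈ P × entry ξ ≡ nothing}
    where open Enumeration A (lower-em p em) ext
  ... | yes (ξ , ξ∈P , eq) = inj₂ (ξ , ξ∈P , index≼ (lower-em p em) A (↓ ξ) Lists (exhausted eq)
      (λ x≈y (z , eq , z≈x) → z , eq , ≈-trans z≈x x≈y) functional)
    where
    open Enumeration A (lower-em p em) ext
    open Setoid A using (_≈_) renaming (sym to ≈-sym; trans to ≈-trans)
    functional : ∀ {x y ξ} → Lists x ξ → Lists y ξ → x ≈ y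
    functional (_ , eq , z≈x) (_ , eq′ , z≈y) with refl ← trans (sym eq) eq′ =
      ≈-trans (≈-sym z≈x) z≈y
  ... | no all = inj₁ record
      { to        = λ (ξ , ξ∈P) → proj₁ (listed ξ∈P)
      ; cong      = λ {(ξ , ξ∈P)} {(η , η∈P)} ξ≡η → Setoid.reflexive A (just-injective
          (trans (sym (proj₂ (listed ξ∈P))) (trans (cong entry ξ≡η) (proj₂ (listed η∈P)))))
      ; injective = λ {(ξ , ξ∈P)} {(η , η∈P)} →
          entry-injective (proj₂ (listed ξ∈P)) (proj₂ (listed η∈P))
      }
    where
    open Enumeration A (lower-em p em) ext
    listed : ∀ {ξ} → ξ ∈ P → ∃ λ x → entry ξ ≡ just x
    listed {ξ} ξ∈P with entry-spec ξ
    ... | inj₁ (x , eq , _) = x , eq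
    ... | inj₂ (eq , _)     = contradiction (ξ , ξ∈P , eq) all

-- Cardinal arithmetic

module CardinalArithmetic {ℓ} (em : ExcludedMiddle (suc ℓ))
                          (ext : Extensionality (suc ℓ) (suc ℓ)) (O : Ordinal ℓ) where
  open Ordinal O
  open OrdinalProperties O

  emˡ : ExcludedMiddle ℓ
  emˡ = lower-em (suc ℓ) em

  extˡ : Extensionality ℓ ℓ
  extˡ = lower-extensionality (suc ℓ) (suc ℓ) ext

  cardinality : ∀ ξ → ∃ λ μ → IsCardinal μ × μ ≤ ξ × ∣ ↓ ξ ∣ ≼ ∣ ↓ μ ∣
  cardinality ξ =
    let μ , ξ≼μ , minimal = least {P = λ μ → ∣ ↓ ξ ∣ ≼ ∣ ↓ μ ∣} emˡ (ξ , ↓-mono (inj₂ refl))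
    in μ , (λ β β<μ μ≼β → <⇒≱ β<μ (minimal (≼-trans ξ≼μ μ≼β)))
         , minimal (↓-mono (inj₂ refl)) , ξ≼μ

  -- The ordinal `m + 1`, written without forming successors.
  ⇓ : Carrier → Pred Carrier ℓ
  ⇓ m x = x ≤ m

  -- Gödel's well-ordering of pairs, whose initial segments lie in squares.
  pairs : Ordinal ℓ
  pairs = pullback (O ×ₗₑₓ O ×ₗₑₓ O) (λ (x , y) → proj₁ (upperBound x y) , x , y) (cong proj₂)

  pairs-↓ : ∀ {ρ w} → w ∈ (↓ ρ ⟨×⟩ ↓ ρ) → ∃ λ m → m < ρ × Ordinal.↓ pairs w ⊆ (⇓ m ⟨×⟩ ⇓ m)
  pairs-↓ {ρ} {x , y} (x<ρ , y<ρ) with upperBound x y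
  ... | m , x≤m , y≤m , which = m , [ (λ { refl → x<ρ }) , (λ { refl → y<ρ }) ]′ which ,
    λ { {v₁ , v₂} v<w → let n≤m = [ inj₁ , inj₂ ∘ proj₁ ]′ v<w
                            _ , v₁≤n , v₂≤n , _ = upperBound v₁ v₂
                        in ≤-trans v₁≤n n≤m , ≤-trans v₂≤n n≤m }

  ℕ⋠Fin : ∀ {n} → ¬ (setoid ℕ ≼ setoid (Fin n))
  ℕ⋠Fin f = Fin.ℕ→Fin-notInjective (Injection.to f) (Injection.injective f)

  -- The listing of `↓ m` along `ω` either never stops or stops at a finite stage.
  finite⊎infinite : ∀ m → setoid ℕ ≼ ∣ ↓ m ∣ ⊎ (∃ λ n → ∣ ↓ m ∣ ≼ setoid (Fin n))
  finite⊎infinite m with OrdinalProperties.enumerate ω ∣ ↓ m ∣ Full emˡ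
                           (lower-extensionality (suc ℓ) (suc ℓ) ext)
  ... | inj₁ ω≼m = inj₁ (≼-trans whole≼Full ω≼m)
  ... | inj₂ (n , _ , m≼n) = inj₂ (n , ≼-trans m≼n record
    { to        = λ (_ , i<n) → Fin.fromℕ< i<n
    ; cong      = λ i≡j → Fin.fromℕ<-cong _ _ i≡j _ _
    ; injective = λ eq → Fin.fromℕ<-injective _ _ _ _ eq })

  ⇓-finite : ∀ {m n} → ∣ ↓ m ∣ ≼ setoid (Fin n) → ∣ ⇓ m ∣ ≼ setoid (Fin (ℕ.suc n))
  ⇓-finite f = record
    { to        = λ { (x , inj₁ x<m) → Fin.suc (F.to (x , x<m)) ; (x , inj₂ _) → Fin.zero }
    ; cong      = λ { {_ , inj₁ _}   {_ , inj₁ _}   eq   → cong Fin.suc (F.cong eq)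
                    ; {_ , inj₁ x<m} {_ , inj₂ y≡m} eq   →
                        contradiction x<m (<-irrefl (trans eq y≡m))
                    ; {_ , inj₂ x≡m} {_ , inj₁ y<m} eq   →
                        contradiction y<m (<-irrefl (trans (sym eq) x≡m))
                    ; {_ , inj₂ _}   {_ , inj₂ _}   eq   → refl }
    ; injective = λ { {_ , inj₁ _}   {_ , inj₁ _}   eq   → F.injective (Fin.suc-injective eq)
                    ; {_ , inj₁ _}   {_ , inj₂ _}   ()
                    ; {_ , inj₂ _}   {_ , inj₁ _}   ()
                    ; {_ , inj₂ x≡m} {_ , inj₂ y≡m} eq   → trans x≡m (sym y≡m) }
    }
    where module F = Injection f

  -- The square has room for the extra point: `x < m` goes to `(x , e 0)` and `m` itself to
  -- `(e 0 , e 1)`, where `e 0` and `e 1` differ.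
  ⇓-infinite : ∀ {m} → setoid ℕ ≼ ∣ ↓ m ∣ → ∣ ⇓ m ∣ ≼ ∣ ↓ m ⟨×⟩ ↓ m ∣
  ⇓-infinite {m} f = record
    { to        = λ { (x , inj₁ x<m) → (x , e 0) , (x<m , e<m 0)
                    ; (x , inj₂ x≡m) → (e 0 , e 1) , (e<m 0 , e<m 1) }
    ; cong      = λ { {_ , inj₁ _}   {_ , inj₁ _}   refl → refl
                    ; {_ , inj₁ x<m} {_ , inj₂ y≡m} eq   →
                        contradiction x<m (<-irrefl (trans eq y≡m))
                    ; {_ , inj₂ x≡m} {_ , inj₁ y<m} eq   →
                        contradiction y<m (<-irrefl (trans (sym eq) x≡m))
                    ; {_ , inj₂ _}   {_ , inj₂ _}   eq   → refl }
    ; injective = λ { {_ , inj₁ _}   {_ , inj₁ _}   eq   → cong proj₁ eq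
                    ; {_ , inj₁ _}   {_ , inj₂ _}   eq   → case F.injective (cong proj₂ eq) of λ ()
                    ; {_ , inj₂ _}   {_ , inj₁ _}   eq   → case F.injective (cong proj₂ eq) of λ ()
                    ; {_ , inj₂ x≡m} {_ , inj₂ y≡m} eq   → trans x≡m (sym y≡m) }
    }
    where
    module F = Injection f
    e : ℕ → Carrier
    e n = proj₁ (F.to n)
    e<m : ∀ n → e n < m
    e<m n = proj₂ (F.to n)

  square-finite : {P : Pred Carrier ℓ} → ∀ {n} → ∣ P ∣ ≼ setoid (Fin n) →
                  ∣ P ⟨×⟩ P ∣ ≼ setoid (Fin (n ℕ.* n))
  square-finite f = record
    { to        = λ ((x , y) , (x∈P , y∈P)) → Fin.combine (F.to (x , x∈P)) (F.to (y , y∈P))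
    ; cong      = λ eq → cong₂ Fin.combine (F.cong (cong proj₁ eq)) (F.cong (cong proj₂ eq))
    ; injective = λ eq → let eq₁ , eq₂ = Fin.combine-injective _ _ _ _ eq
                         in cong₂ _,_ (F.injective eq₁) (F.injective eq₂)
    }
    where module F = Injection f

  SquareAbsorbed : Pred Carrier ℓ
  SquareAbsorbed m = setoid ℕ ≼ ∣ ↓ m ∣ → ∣ ↓ m ⟨×⟩ ↓ m ∣ ≼ ∣ ↓ m ∣

  -- For finite `m` the square of `m + 1` is finite, and for infinite `m` it is no larger than `m`;
  -- neither reaches the infinite cardinal `ρ`.
  square-below : ∀ {ρ m} → IsInfiniteCardinal ρ → m < ρ → SquareAbsorbed m →
                 ¬ (∣ ↓ ρ ∣ ≼ ∣ ⇓ m ⟨×⟩ ⇓ m ∣)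
  square-below {ρ} {m} (card , ℕ≼ρ) m<ρ absorbed ρ≼ with finite⊎infinite m
  ... | inj₂ (n , m≼n) = ℕ⋠Fin (≼-trans ℕ≼ρ (≼-trans ρ≼ (square-finite (⇓-finite m≼n))))
  ... | inj₁ ℕ≼m = card m m<ρ (≼-trans ρ≼ (≼-trans (⟨×⟩-mono ⇓≼ ⇓≼) (absorbed ℕ≼m)))
    where
    ⇓≼ : ∣ ⇓ m ∣ ≼ ∣ ↓ m ∣
    ⇓≼ = ≼-trans (⇓-infinite ℕ≼m) (absorbed ℕ≼m)

  -- Hessenberg's theorem, by induction. If `ρ` is not a cardinal, pass to its cardinality. If it is
  -- one, list `ρ` along Gödel's order of its pairs: a listing that stops would put `ρ` into the
  -- square of some `m + 1` with `m < ρ`.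
  square-absorbed : ∀ ρ → SquareAbsorbed ρ
  square-absorbed = All.wfRec wellFounded _ SquareAbsorbed λ ρ IH ℕ≼ρ →
    case cardinality ρ of λ
    { (μ , _ , inj₁ μ<ρ , ρ≼μ) →
        ≼-trans (⟨×⟩-mono ρ≼μ ρ≼μ) (≼-trans (IH μ<ρ (≼-trans ℕ≼ρ ρ≼μ)) (↓-mono (inj₁ μ<ρ)))
    ; (_ , card , inj₂ refl , _) →
        case OrdinalProperties.enumerate pairs ∣ ↓ ρ ∣ (↓ ρ ⟨×⟩ ↓ ρ) emˡ extˡ of λ
        { (inj₁ ρ²≼ρ) → ρ²≼ρ
        ; (inj₂ (w , w∈ρ² , ρ≼w)) → let m , m<ρ , w⊆ = pairs-↓ w∈ρ² in
            contradiction (≼-trans ρ≼w (⊆⇒≼ w⊆)) (square-below (card , ℕ≼ρ) m<ρ (IH m<ρ))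
        }
    }

  product-below : ∀ {ρ μ τ} → IsInfiniteCardinal ρ → μ < ρ → τ < ρ →
                  ¬ (∣ ↓ ρ ∣ ≼ ∣ ↓ μ ⟨×⟩ ↓ τ ∣)
  product-below {ρ} {μ} {τ} inf μ<ρ τ<ρ ρ≼ with upperBound μ τ
  ... | m , μ≤m , τ≤m , which =
    square-below inf ([ (λ { refl → μ<ρ }) , (λ { refl → τ<ρ }) ]′ which) (square-absorbed m)
      (≼-trans ρ≼ (⊆⇒≼ λ (x<μ , y<τ) → inj₁ (<-≤-trans x<μ μ≤m) , inj₁ (<-≤-trans y<τ τ≤m)))

  ⇓-below : ∀ {ρ x} → IsInfiniteCardinal ρ → x < ρ → ¬ (∣ ↓ ρ ∣ ≼ ∣ ⇓ x ∣)
  ⇓-below inf x<ρ ρ≼⇓ = square-below inf x<ρ (square-absorbed _) (≼-trans ρ≼⇓ record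
    { to        = λ (y , y≤x) → (y , y) , (y≤x , y≤x)
    ; cong      = λ { refl → refl }
    ; injective = cong proj₁ })

  -- Were the union all of `ρ`, the pairs of an index `ξ` and the code of `y` in `s ξ` would inject
  -- `ρ` into the product of `μ` and `τ`.
  avoid-union : ∀ {ρ μ τ} → IsInfiniteCardinal ρ → μ < ρ → τ < ρ →
    (s : Carrier → Pred Carrier ℓ) → (∀ {ξ} → ξ < μ → ∣ s ξ ∣ ≼ ∣ ↓ τ ∣) →
    ∃ λ y → y < ρ × ¬ (∃ λ ξ → ξ < μ × y ∈ s ξ)
  avoid-union {ρ} {μ} {τ} inf μ<ρ τ<ρ s s≼τ = decidable-stable emˡ λ none →
    product-below inf μ<ρ τ<ρ (OrdinalProperties.index≼ pairs emˡ ∣ ↓ ρ ∣ (↓ μ ⟨×⟩ ↓ τ)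
      (λ (y , _) → At y)
      (λ (y , y<ρ) → at (decidable-stable emˡ λ uncovered → none (y , y<ρ , uncovered)))
      (λ { refl at → at })
      functional)
    where
    -- The injection of `s ξ` may depend on the proof of `ξ < μ`. With `True` that proof is unique,
    -- so equal codes at the same `ξ` come from the same injection.
    code : ∀ {ξ y} → True (ξ <? μ) → y ∈ s ξ → ∃ (↓ τ)
    code p y∈sξ = Injection.to (s≼τ (toWitness p)) (_ , y∈sξ)

    At : Carrier → Pred (Carrier × Carrier) ℓ
    At y (ξ , t) = ∃ λ (p : True (ξ <? μ)) → ∃ λ (y∈sξ : y ∈ s ξ) → proj₁ (code p y∈sξ) ≡ t

    at : ∀ {y} → (∃ λ ξ → ξ < μ × y ∈ s ξ) → ∃ λ w → w ∈ (↓ μ ⟨×⟩ ↓ τ) × At y w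
    at (ξ , ξ<μ , y∈sξ) = let t , t<τ = code (fromWitness ξ<μ) y∈sξ
      in (ξ , t) , (ξ<μ , t<τ) , fromWitness ξ<μ , y∈sξ , refl

    functional : ∀ {x y w} → At x w → At y w → x ≡ y
    functional (p , x∈sξ , eq) (p′ , y∈sξ , eq′) with refl ← T-irrelevant p p′ =
      Injection.injective (s≼τ (toWitness p)) (trans eq (sym eq′))

  -- Reads "cf(ρ) ≤ μ" without naming the cofinality.
  CofinalOfSize≤ : Carrier → Pred Carrier (suc ℓ)
  CofinalOfSize≤ ρ μ = ∃ λ X → CofinalBelow ρ X × ∣ X ∣ ≼ ∣ ↓ μ ∣

  -- The least `ν` that bounds the size of some cofinal set is a cardinal, since a smaller bound
  -- would contradict its choice. For the same reason no cofinal set is smaller than `ν`, and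
  -- Schröder-Bernstein gives one of exactly this size.
  cofinality : ∀ {ρ μ} → CofinalOfSize≤ ρ μ → ∃ λ ν → Cf ρ ν × ν ≤ μ
  cofinality {ρ} {μ} small with least {P = CofinalOfSize≤ ρ} em (μ , small)
  ... | ν , (Y , cofY , Y≼ν) , minimal =
    ν , ((λ β β<ν ν≼β → <⇒≱ β<ν (minimal (Y , cofY , ≼-trans Y≼ν ν≼β)))
        , (Y , cofY , ≼-antisym emˡ Y≼ν (lower-bound Y cofY))
        , lower-bound)
      , minimal small
    where
    lower-bound : ∀ Z → CofinalBelow ρ Z → ∣ ↓ ν ∣ ≼ ∣ Z ∣
    lower-bound Z cofZ with enumerate ∣ Z ∣ (↓ ν) emˡ extˡ
    ... | inj₁ ν≼Z = ν≼Z
    ... | inj₂ (ξ , ξ<ν , Z≼ξ) = contradiction (minimal (Z , cofZ , Z≼ξ)) (<⇒≱ ξ<ν)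

  -- The sizes of the sets `s ξ` form a subset of `ρ` with at most `μ` elements, which cannot be
  -- cofinal; a point that none of them reaches is the bound.
  common-bound : ∀ {ρ μ} → ¬ CofinalOfSize≤ ρ μ →
    (s : Carrier → Pred Carrier ℓ) → (∀ {ξ} → ξ < μ → ∣ s ξ ∣ ≺ ∣ ↓ ρ ∣) →
    ∃ λ τ → τ < ρ × (∀ {ξ} → ξ < μ → ∣ s ξ ∣ ≼ ∣ ↓ τ ∣)
  common-bound {ρ} {μ} large s s≺ρ =
    let τ , ¬cof  = ¬∀⟶∃¬ emˡ λ cof → large
          (Sizes , ((λ (_ , _ , (t<ρ , _) , _) → t<ρ) , cof) , Sizes≼μ)
        τ<ρ , ¬cof′ = ¬∀⟶∃¬ emˡ ¬cof
    in τ , τ<ρ , λ {ξ} ξ<μ →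
      let t , bnd , minimal = least emˡ (size ξ<μ)
      in ≼-trans (proj₂ bnd)
           (↓-mono (inj₁ (≰⇒> λ τ≤t → ¬cof′ (t , (ξ , ξ<μ , bnd , minimal) , τ≤t))))
    where
    Bounds : Carrier → Pred Carrier ℓ
    Bounds ξ t = t < ρ × ∣ s ξ ∣ ≼ ∣ ↓ t ∣

    -- Only least bounds are collected, so that `ξ` determines `t`.
    Sizes : Pred Carrier ℓ
    Sizes t = ∃ λ ξ → ξ < μ × Bounds ξ t × (∀ {t′} → Bounds ξ t′ → t ≤ t′)

    size : ∀ {ξ} → ξ < μ → ∃ (Bounds ξ)
    size {ξ} ξ<μ with enumerate ∣ s ξ ∣ (↓ ρ) emˡ extˡ
    ... | inj₁ ρ≼s = contradiction ρ≼s (proj₂ (s≺ρ ξ<μ))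
    ... | inj₂ t   = t

    Sizes≼μ : ∣ Sizes ∣ ≼ ∣ ↓ μ ∣
    Sizes≼μ = index≼ emˡ ∣ Sizes ∣ (↓ μ)
      (λ (t , _) ξ → Bounds ξ t × (∀ {t′} → Bounds ξ t′ → t ≤ t′))
      (λ (_ , ξ , ξ<μ , least) → ξ , ξ<μ , least)
      (λ { refl least → least })
      (λ (bnd , minimal) (bnd′ , minimal′) → ≤-antisym (minimal bnd′) (minimal′ bnd))

-- Successor cardinals, clubs and stationary sets

module InitialSegment {ℓ} (O : Ordinal ℓ) (ξ : Ordinal.Carrier O) where
  open Ordinal O
  open OrdinalProperties O

  -- `True` makes membership proofs unique, so that propositional equality on this type is equality
  -- of first components, as an `Ordinal` requires.
  Segment : Set ℓ
  Segment = ∃ λ x → True (x <? ξ)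

  proj₁-injective : {x y : Segment} → proj₁ x ≡ proj₁ y → x ≡ y
  proj₁-injective {_ , p} {_ , q} refl = cong (_ ,_) (T-irrelevant p q)

  segment : Ordinal ℓ
  segment = pullback O proj₁ proj₁-injective

  segment≼↓ : setoid Segment ≼ ∣ ↓ ξ ∣
  segment≼↓ = record
    { to = λ (x , p) → x , toWitness p ; cong = cong proj₁ ; injective = proj₁-injective }

  ↓≼segment : ∣ ↓ ξ ∣ ≼ setoid Segment
  ↓≼segment = record
    { to = λ (x , x<ξ) → x , fromWitness x<ξ ; cong = proj₁-injective ; injective = cong proj₁ }

  segment-↓ : ∀ α → ∣ Ordinal.↓ segment α ∣ ≼ ∣ ↓ (proj₁ α) ∣
  segment-↓ α = record
    { to        = λ ((x , _) , x<α) → x , x<α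
    ; cong      = cong proj₁
    ; injective = proj₁-injective
    }

module _ {ℓ} (em : ExcludedMiddle ℓ) (ext : Extensionality ℓ ℓ) {κ κ⁺ : Ordinal ℓ}
         (κ⁺-succ : IsSuccessorCardinal κ κ⁺) where
  private
    module κ = Ordinal κ
  open Ordinal κ⁺
  open OrdinalProperties κ⁺

  -- At a least counterexample `μ`, all smaller segments inject into `κ`, so the segment of `μ` is
  -- an initial ordinal above `κ`. Then `κ⁺` injects into it, contrary to `κ⁺` being initial.
  below-successor : ∀ ξ → ∣ ↓ ξ ∣ ≼ κ.whole
  below-successor ξ = decidable-stable em λ ξ⋠κ →
    let initial , _ , smallest = κ⁺-succ
        μ , μ⋠κ , minimal = least {P = λ μ → ¬ (∣ ↓ μ ∣ ≼ κ.whole)} em (ξ , ξ⋠κ)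
        open InitialSegment κ⁺ μ
        segment⋠κ : ¬ (setoid Segment ≼ κ.whole)
        segment⋠κ s≼κ = μ⋠κ (≼-trans ↓≼segment s≼κ)
        segment-initial : IsInitial segment
        segment-initial = λ (α , α<μ) s≼α → <⇒≱ (toWitness α<μ)
          (minimal λ α≼κ → segment⋠κ (≼-trans s≼α (≼-trans (segment-↓ (α , α<μ)) α≼κ)))
        κ≼segment : κ.whole ≼ setoid Segment
        κ≼segment = case OrdinalProperties.enumerate κ (setoid Segment) Full em ext of λ
          { (inj₁ κ≼s) → ≼-trans whole≼Full κ≼s
          ; (inj₂ (β , _ , s≼β)) → contradiction (≼-trans s≼β ≼-whole) segment⋠κ }
    in initial μ (≼-trans (smallest segment segment-initial (κ≼segment , segment⋠κ)) segment≼↓)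

module Regular {ℓ} (em : ExcludedMiddle ℓ) (κ : Ordinal ℓ) (initial : IsInitial κ)
               (uncountable : IsUncountable κ) (regular : IsRegular κ) where
  open Ordinal κ
  open OrdinalProperties κ

  ¬cofinal⇒bounded : {X : Pred Carrier p} → ExcludedMiddle (ℓ ⊔ p) → ¬ Cofinal X → Bounded X
  ¬cofinal⇒bounded em′ ¬cof =
    let β , none = ¬∀⟶∃¬ em′ ¬cof
    in β , λ {x} x∈X → ≰⇒> λ β≤x → none (x , x∈X , β≤x)

  small⇒bounded : {X : Pred Carrier ℓ} → ¬ (whole ≼ ∣ X ∣) → Bounded X
  small⇒bounded {X} small = ¬cofinal⇒bounded em λ cof → small (regular X cof)

  -- Least preimages inject the image into `↓ ν`, which is smaller than `κ`; regularity then bounds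
  -- it.
  bounded-image : (F : Carrier → Carrier) → ∀ ν → ∃ λ θ → ∀ {η} → η < ν → F η < θ
  bounded-image F ν =
    let θ , bnd = small⇒bounded {X = λ y → ∃ λ η → η < ν × F η ≡ y} λ κ≼X →
          initial ν (≼-trans κ≼X (index≼ em _ (↓ ν) (λ (y , _) η → F η ≡ y) proj₂
            (λ { refl eq → eq }) (λ eq eq′ → trans (sym eq) eq′)))
    in θ , λ η<ν → bnd (_ , η<ν , refl)

  bounded-sequence : (s : ℕ → Carrier) → ∃ λ θ → ∀ n → s n < θ
  bounded-sequence s =
    let θ , bnd = small⇒bounded {X = λ y → ∃ λ n → s n ≡ y} λ κ≼X →
          uncountable (≼-trans κ≼X (≼-trans
            (OrdinalProperties.index≼ ω em _ Full (λ (y , _) n → s n ≡ y)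
              (λ (_ , n , eq) → n , _ , eq)
              (λ { refl eq → eq }) (λ eq eq′ → trans (sym eq) eq′))
            ≼-whole))
    in θ , λ n → bnd (n , refl)

  above : ∀ β → ∃ λ γ → β < γ
  above β = let θ , bnd = bounded-sequence (λ _ → β) in θ , bnd 0

  ClosedUnder : (Carrier → Carrier) → Pred Carrier ℓ
  ClosedUnder F γ = IsLimit γ × (∀ {η} → η < γ → F η < γ)

  -- Cofinality comes from iterating `next` along the natural numbers; the supremum exists because
  -- `κ` is regular and uncountable.
  closedUnder-club : ∀ F → IsClub (ClosedUnder F)
  closedUnder-club F = cofinal , closed
    where
    next : ∀ β → ∃ λ γ → β < γ × (∀ {η} → η < β → F η < γ)
    next β =
      let γ , β<γ = above β
          θ , bnd = bounded-image F β
          δ , γ≤δ , θ≤δ , _ = upperBound γ θ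
      in δ , <-≤-trans β<γ γ≤δ , λ η<β → <-≤-trans (bnd η<β) θ≤δ

    cofinal : Cofinal (ClosedUnder F)
    cofinal β = γ , ((( β , s<γ 0) , λ x x<γ → let n , x≤s = reached x<γ
                        in s (ℕ.suc n) , ≤-<-trans x≤s (s<s n) , s<γ (ℕ.suc n))
                    -- From `η ≤ s n < s (n + 1)` it follows that `F η < s (n + 2)`, since `next`
                    -- bounds `F` strictly below its argument.
                    , λ η<γ → let n , η≤s = reached η<γ in
                        <-trans (proj₂ (proj₂ (next (s (ℕ.suc n)))) (≤-<-trans η≤s (s<s n)))
                                (s<γ (ℕ.suc (ℕ.suc n))))
                  , inj₁ (s<γ 0)
      where
      s : ℕ → Carrier
      s ℕ.zero    = β
      s (ℕ.suc n) = proj₁ (next (s n))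
      s<s : ∀ n → s n < s (ℕ.suc n)
      s<s n = proj₁ (proj₂ (next (s n)))
      sup : ∃ λ γ → (∀ n → s n < γ) × (∀ {θ} → (∀ n → s n < θ) → γ ≤ θ)
      sup = least em (bounded-sequence s)
      γ = proj₁ sup
      s<γ = proj₁ (proj₂ sup)
      reached : ∀ {x} → x < γ → ∃ λ n → x ≤ s n
      reached x<γ =
        let n , s≮x = ¬∀⟶∃¬ em λ s<x → <⇒≱ x<γ (proj₂ (proj₂ sup) s<x) in n , ≮⇒≥ s≮x

    closed : ∀ γ → IsLimit γ → (∀ β → β < γ → ∃ λ δ → δ ∈ ClosedUnder F × β ≤ δ × δ < γ) →
             γ ∈ ClosedUnder F
    closed γ lim approx = lim , λ η<γ →
      -- The intermediate `η′` is needed because `approx` only yields `δ` at or above its argument,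
      -- while `η < δ` is required.
      let η′ , η<η′ , η′<γ = proj₂ lim _ η<γ
          δ , (_ , closed-δ) , η′≤δ , δ<γ = approx η′ η′<γ
      in <-trans (closed-δ (<-≤-trans η<η′ η′≤δ)) δ<γ

  -- The supremum of the elements of `C` up to `α` is one of them or a limit of them, hence in `C`.
  -- It is chosen before any `δ₀` is given, which makes it a function of `α`; when no element of `C`
  -- is at most `α`, its value is a mere default.
  greatest-below : ∀ {C} → IsClub C → ∀ α →
    ∃ λ δ → ∀ {δ₀} → δ₀ ∈ C → δ₀ ≤ α → δ ∈ C × δ ≤ α × δ₀ ≤ δ
  greatest-below {C} (_ , closed) α with least {P = Bounds} em (α , λ _ _ γ≤α → γ≤α)
    where
    Bounds : Pred Carrier ℓ
    Bounds δ = ∀ γ → γ ∈ C → γ ≤ α → γ ≤ δ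
  ... | δ , bound , minimal = δ , λ δ₀∈C δ₀≤α →
    decidable-stable em (λ δ∉C → δ∉C (closed δ (limit δ₀∈C δ₀≤α δ∉C) (λ β β<δ →
      let γ , γ∈C , β<γ , γ<δ = approx δ∉C β<δ in γ , γ∈C , inj₁ β<γ , γ<δ)))
    , minimal (λ _ _ γ≤α → γ≤α) , bound _ δ₀∈C δ₀≤α
    where
    strict : ¬ (δ ∈ C) → ∀ {γ} → γ ∈ C → γ ≤ α → γ < δ
    strict δ∉C {γ} γ∈C γ≤α with bound γ γ∈C γ≤α
    ... | inj₁ γ<δ  = γ<δ
    ... | inj₂ refl = contradiction γ∈C δ∉C

    approx : ¬ (δ ∈ C) → ∀ {β} → β < δ → ∃ λ γ → γ ∈ C × β < γ × γ < δ
    approx δ∉C {β} β<δ = decidable-stable em λ none → <⇒≱ β<δ (minimal λ γ γ∈C γ≤α →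
      ≮⇒≥ λ β<γ → none (γ , γ∈C , β<γ , strict δ∉C γ∈C γ≤α))

    limit : ∀ {δ₀} → δ₀ ∈ C → δ₀ ≤ α → ¬ (δ ∈ C) → IsLimit δ
    limit δ₀∈C δ₀≤α δ∉C = (_ , strict δ∉C δ₀∈C δ₀≤α) ,
      λ β β<δ → let γ , _ , β<γ , γ<δ = approx δ∉C β<δ in γ , β<γ , γ<δ

  module _ (P : Carrier → Pred Carrier ℓ) where

    bounds : ¬ (∃ λ ξ → Cofinal (P ξ)) → ∀ ξ → Bounded (P ξ)
    bounds none ξ = ¬cofinal⇒bounded em λ cof → none (ξ , cof)

    abstract
      -- If every `P ξ` were bounded, regularity would give the bounds for `ξ < ν` a common bound,
      -- and with it a bound for their union.
      pigeonhole : ∀ ν → Cofinal (λ α → ∃ λ ξ → ξ < ν × P ξ α) → ∃ λ ξ → Cofinal (P ξ)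
      pigeonhole ν cof = decidable-stable em λ none →
        let θ , bnd = bounded-image (proj₁ ∘ bounds none) ν
            α , (ξ , ξ<ν , Pξα) , θ≤α = cof θ
        in <⇒≱ (<-trans (proj₂ (bounds none ξ) Pξα) (bnd ξ<ν)) θ≤α

      -- A form of Fodor's lemma. If every `P ξ` were bounded, `S` would contain a limit `γ` closed
      -- under these bounds; the bound of `P ξ` is then below `γ` for `ξ < γ`, yet `P ξ` has an
      -- element `α ≥ γ`.
      pressing-down : ∀ {S} → IsStationary S →
        (∀ {γ} → γ ∈ S → IsLimit γ → ∃ λ ξ → ξ < γ × (∃ λ α → γ ≤ α × P ξ α)) →
        ∃ λ ξ → Cofinal (P ξ)
      pressing-down stationary regressive = decidable-stable em λ none →
        let γ , γ∈S , lim , closed =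
              stationary _ (closedUnder-club (proj₁ ∘ bounds none))
            ξ , ξ<γ , α , γ≤α , Pξα = regressive γ∈S lim
        in <⇒≱ (<-trans (proj₂ (bounds none ξ) Pξα) (closed ξ<γ)) γ≤α

-- The antilocalisation cardinal

module Antilocalisation {ℓ} (em : ExcludedMiddle (suc ℓ))
  (ext : Extensionality (suc ℓ) (suc ℓ)) (κ : Ordinal ℓ)
  (b h : Ordinal.Carrier κ → Ordinal.Carrier κ) (κ-inaccessible : IsInaccessible κ)
  (h≤b : ∀ α → Ordinal._≤_ κ (h α) (b α))
  (b-infinite : ∀ α → Ordinal.IsInfiniteCardinal κ (b α))
  (2≼h : ∀ α → setoid (Fin 2) ≼ ∣ Ordinal.↓ κ (h α) ∣) where
  open Ordinal κ
  open OrdinalProperties κ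
  open CardinalArithmetic em ext κ
  open Localisation κ b h
  open Regular emˡ κ (proj₁ κ-inaccessible) (proj₁ (proj₂ κ-inaccessible))
    (proj₁ (proj₂ (proj₂ κ-inaccessible)))

  bottom : ∀ α → ∃ λ y → y < b α
  bottom α = Injection.to (proj₂ (b-infinite α)) 0

  -- Covers of a coordinate and the slaloms built from them

  Small : Carrier → Pred (Pred Carrier ℓ) ℓ
  Small α X = X ⊆ ↓ (b α) × ∣ X ∣ ≺ ∣ ↓ (h α) ∣

  subsingleton-small : ∀ {α X} → X ⊆ ↓ (b α) → (∀ {x y} → x ∈ X → y ∈ X → x ≡ y) → Small α X
  subsingleton-small X⊆b unique = X⊆b , subsingleton≺ unique (2≼h _)

  -- All `c ξ` are required to be small, not only those with `ξ < ν`, so that covers of different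
  -- coordinates assemble into slaloms indexed by `κ`.
  Coverable : Carrier → Pred Carrier (suc ℓ)
  Coverable α ν = ∃ λ (c : Slalom) → (∀ ξ → c ξ ∈ Small α) ×
    (∀ {y} → y < b α → ∃ λ ξ → ξ < ν × y ∈ c ξ)

  coverable-singletons : ∀ {α ν} → b α ≤ ν → Coverable α ν
  coverable-singletons {α} b≤ν = (λ ξ y → y ≡ ξ × y < b α) ,
    (λ ξ → subsingleton-small proj₂ λ (x≡ξ , _) (y≡ξ , _) → trans x≡ξ (sym y≡ξ)) ,
    λ {y} y<b → y , <-≤-trans y<b b≤ν , refl , y<b

  -- A bounded closed segment of the infinite cardinal `b α` is smaller than `b α`, which here
  -- equals `h α`, and the segments along a cofinal set exhaust `b α`.
  coverable-segments : ∀ {α μ} → h α ≡ b α → Cf (b α) μ → Coverable α μ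
  coverable-segments {α} {μ} h≡b (_ , (X , (X⊆b , cof) , X≃μ) , _) =
    segment-below , (λ ξ → below-b , ≼h , h⋠) , covered
    where
    open Bijection X≃μ using (to; injective)
    segment-below : Slalom
    segment-below ξ y = ∃ λ (x : ∃ X) → proj₁ (to x) ≡ ξ × y ≤ proj₁ x

    below-b : ∀ {ξ} → segment-below ξ ⊆ ↓ (b α)
    below-b ((x , x∈X) , _ , y≤x) = ≤-<-trans y≤x (X⊆b x∈X)

    ≼h : ∀ {ξ} → ∣ segment-below ξ ∣ ≼ ∣ ↓ (h α) ∣
    ≼h {ξ} = subst (λ β → ∣ segment-below ξ ∣ ≼ ∣ ↓ β ∣) (sym h≡b) (⊆⇒≼ below-b)

    h⋠ : ∀ {ξ} → ¬ (∣ ↓ (h α) ∣ ≼ ∣ segment-below ξ ∣)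
    -- Since `h α` is nonempty, so is the set, and this provides an `x` with index `ξ`. The
    -- enumeration of `X` is injective, so `x` is the only one and the set lies in `⇓ x`.
    h⋠ {ξ} h≼ with Injection.to (≼-trans (2≼h α) h≼) Fin.zero
    ... | _ , ((x , x∈X) , x≡ξ , _) = ⇓-below (b-infinite α) (X⊆b x∈X)
      (≼-trans (subst (λ β → ∣ ↓ β ∣ ≼ ∣ segment-below ξ ∣) h≡b h≼)
          (⊆⇒≼ λ ((x′ , x′∈X) , x′≡ξ , y≤x′) →
        subst (_ ≤_) (injective {x′ , x′∈X} {x , x∈X} (trans x′≡ξ (sym x≡ξ))) y≤x′))

    covered : ∀ {y} → y < b α → ∃ λ ξ → ξ < μ × y ∈ segment-below ξ
    covered y<b = let x , x∈X , y≤x = cof _ y<b ; ξ , ξ<μ = to (x , x∈X)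
                  in ξ , ξ<μ , (x , x∈X) , refl , y≤x

  D⇒coverable : ∀ {α μ} → α ∈ D μ → ∃ λ ν → ν ≤ μ × Coverable α ν
  D⇒coverable (inj₁ b≤μ)                  = _ , inj₂ refl , coverable-singletons b≤μ
  D⇒coverable (inj₂ (h≡b , ν , cf , ν≤μ)) = ν , ν≤μ , coverable-segments h≡b cf

  abstract
    -- Using a cover of least length at every coordinate makes one family serve all `ν` at once: if
    -- `ν` sets can cover `b α`, the first `ν` slaloms do.
    coveringFamily : ∃ λ (φ : Carrier → Slalom) → (∀ ξ → φ ξ ∈ Loc) ×
      (∀ {α ν y} → Coverable α ν → y < b α → ∃ λ ξ → ξ < ν × y ∈ φ ξ α)
    coveringFamily = (λ ξ α → proj₁ (cover α) ξ) , (λ ξ α → proj₁ (proj₂ (cover α)) ξ) , covers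
      where
      leastCover : ∀ α → ∃ λ ν → Coverable α ν × (∀ {μ} → Coverable α μ → ν ≤ μ)
      leastCover α = least em (b α , coverable-singletons (inj₂ refl))
      cover : ∀ α → Coverable α (proj₁ (leastCover α))
      cover α = proj₁ (proj₂ (leastCover α))
      covers : ∀ {α ν y} → Coverable α ν → y < b α →
               ∃ λ ξ → ξ < ν × y ∈ proj₁ (cover α) ξ
      covers {α} cov y<b with proj₂ (proj₂ (cover α)) y<b
      ... | ξ , ξ<ν , y∈ = ξ , <-≤-trans ξ<ν (proj₂ (proj₂ (leastCover α)) cov) , y∈

  coveringSlalom : Carrier → Slalom
  coveringSlalom = proj₁ coveringFamily

  coveringSlalom-loc : ∀ ξ → coveringSlalom ξ ∈ Loc
  coveringSlalom-loc = proj₁ (proj₂ coveringFamily)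

  coveringSlalom-covers : ∀ {α ν y} → Coverable α ν → y < b α →
                          ∃ λ ξ → ξ < ν × y ∈ coveringSlalom ξ α
  coveringSlalom-covers = proj₂ (proj₂ coveringFamily)

  constantSlalom : Carrier → Slalom
  constantSlalom ξ α y = y ≡ ξ × y < b α

  constantSlalom-loc : ∀ ξ → constantSlalom ξ ∈ Loc
  constantSlalom-loc ξ α = subsingleton-small proj₂ λ (x≡ξ , _) (y≡ξ , _) → trans x≡ξ (sym y≡ξ)

  ∈∞-cofinal : ∀ {f φ} → Cofinal (λ α → f α ∈ φ α) → f ∈∞ φ
  ∈∞-cofinal cof β = let γ , β<γ = above β
                         α , fα∈ , γ≤α = cof γ
                     in α , <-≤-trans β<γ γ≤α , fα∈

  -- Changing φ ξ on the coordinates up to ξ makes the family injective and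
  -- does not affect _∈∞_.
  module _ (φ : Carrier → Slalom) where

    separatedAt : ∀ ξ α → Tri (ξ < α) (ξ ≡ α) (α < ξ) → Pred Carrier ℓ
    separatedAt ξ α (tri< _ _ _) = φ ξ α
    separatedAt ξ α (tri≈ _ _ _) = _≡ proj₁ (bottom α)
    separatedAt ξ α (tri> _ _ _) = λ _ → ⊥

    separated : Carrier → Slalom
    separated ξ α = separatedAt ξ α (compare ξ α)

    separated-loc : (∀ ξ → φ ξ ∈ Loc) → ∀ ξ → separated ξ ∈ Loc
    separated-loc loc ξ α with compare ξ α
    ... | tri< _ _ _ = loc ξ α
    ... | tri≈ _ _ _ = subsingleton-small (λ { refl → proj₂ (bottom α) })
                                          (λ x≡ y≡ → trans x≡ (sym y≡))
    ... | tri> _ _ _ = subsingleton-small (λ ()) (λ ())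

    separated-∈∞ : ∀ {f} ξ → f ∈∞ φ ξ → f ∈∞ separated ξ
    separated-∈∞ {f} ξ f∈φ β =
      let δ , ξ≤δ , β≤δ , _ = upperBound ξ β
          α , δ<α , fα∈ = f∈φ δ
      in α , ≤-<-trans β≤δ δ<α , member (≤-<-trans ξ≤δ δ<α) fα∈
      where
      member : ∀ {α} → ξ < α → f α ∈ φ ξ α → f α ∈ separated ξ α
      member {α} ξ<α fα∈ with compare ξ α
      ... | tri< _ _ _   = fα∈
      ... | tri≈ ξ≮α _ _ = contradiction ξ<α ξ≮α
      ... | tri> ξ≮α _ _ = contradiction ξ<α ξ≮α

    diagonal : ∀ ξ → proj₁ (bottom ξ) ∈ separated ξ ξ
    diagonal ξ with compare ξ ξ
    ... | tri< _ ξ≢ξ _ = contradiction refl ξ≢ξ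
    ... | tri≈ _ _ _   = refl
    ... | tri> _ ξ≢ξ _ = contradiction refl ξ≢ξ

    empty-below : ∀ {ξ α y} → α < ξ → ¬ (y ∈ separated ξ α)
    empty-below {ξ} {α} α<ξ y∈ with compare ξ α
    ... | tri< _ _ ξ≯α = ξ≯α α<ξ
    ... | tri≈ _ _ ξ≯α = ξ≯α α<ξ
    ... | tri> _ _ _   = case y∈ of λ ()

    -- The index `ξ` is recovered as the first coordinate with a nonempty value.
    separated-injective : ∀ {ξ η} → (∀ α → separated ξ α ≐ separated η α) → ξ ≡ η
    separated-injective {ξ} {η} eq with compare ξ η
    ... | tri< ξ<η _ _ = contradiction (proj₁ (eq ξ) (diagonal ξ)) (empty-below ξ<η)
    ... | tri≈ _ ξ≡η _ = ξ≡η
    ... | tri> _ _ η<ξ = contradiction (proj₂ (eq η) (diagonal η)) (empty-below η<ξ)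

  -- The value of the cardinal calls for a witness of size exactly `A`, while the slaloms `φ ξ` may
  -- repeat; their separated copies do not.
  witness : {A : Setoid ℓ ℓ} (index : A ≼ whole) (φ : Carrier → Slalom) →
    (∀ ξ → φ ξ ∈ Loc) →
    (∀ f → f ∈ ∏b → ∃ λ x → f ∈∞ φ (Injection.to index x)) →
    ∃ λ Φ → IsWitness Φ × subset slalomSetoid Φ ≃ A
  witness {A} index φ loc caught = Φ , (Φ⊆Loc , caught′) , record
    { to        = label
    ; cong      = λ {x} {y} → label-cong {x} {y}
    ; bijective = (λ {(ψ , x , ψ≈)} {(ψ′ , x′ , ψ′≈)} x≈x′ → S.trans ψ≈
          (S.trans (S.reflexive (cong (separated φ) (index-cong x≈x′))) (S.sym ψ′≈)))
        , λ x → (separated φ (index-to x) , x , S.refl) ,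
                λ {y} → label-cong {y} {separated φ (index-to x) , x , S.refl}
    }
    where
    open Injection index using (injective) renaming (to to index-to; cong to index-cong)
    module S = Setoid slalomSetoid
    Φ : Pred Slalom ℓ
    Φ ψ = ∃ λ x → ψ S.≈ separated φ (index-to x)
    label : ∃ Φ → Setoid.Carrier A
    label (_ , x , _) = x
    label-cong : {ψ ψ′ : ∃ Φ} → proj₁ ψ S.≈ proj₁ ψ′ → Setoid._≈_ A (label ψ) (label ψ′)
    label-cong {_ , _ , ψ≈} {_ , _ , ψ′≈} ψ≈ψ′ =
      injective (separated-injective φ (S.trans (S.sym ψ≈) (S.trans ψ≈ψ′ ψ′≈)))
    Φ⊆Loc : Φ ⊆ Loc
    Φ⊆Loc (x , ψ≐) α =
      let ⊆b , small = separated-loc φ loc (index-to x) α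
      in ⊆b ∘ proj₁ (ψ≐ α) , ≺-resp-⊆ (proj₁ (ψ≐ α)) small
    caught′ : ∀ f → f ∈ ∏b → ∃ λ ψ → ψ ∈ Φ × f ∈∞ ψ
    caught′ f f∈ = let x , f∈φ = caught f f∈
      in separated φ (index-to x) , (x , S.refl) , separated-∈∞ φ (index-to x) f∈φ

  -- Evading few slaloms

  Room : Carrier → Pred Carrier (suc ℓ)
  Room α ν = ν < b α × (h α ≡ b α → ¬ CofinalOfSize≤ (b α) ν)

  module _ (g : Carrier → Slalom) (g-loc : ∀ ξ → g ξ ∈ Loc) where

    -- If `h α < b α`, then `h α` itself is a common bound on the sizes; otherwise one comes from
    -- the cofinality of `b α`.
    evade-at : ∀ {α ν} → Room α ν → ∃ λ y → y < b α × ¬ (∃ λ ξ → ξ < ν × y ∈ g ξ α)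
    evade-at {α} {ν} (ν<b , regular) with h≤b α
    ... | inj₁ h<b = avoid-union (b-infinite α) ν<b h<b (λ ξ → g ξ α)
                       (λ {ξ} _ → proj₁ (proj₂ (g-loc ξ α)))
    ... | inj₂ h≡b =
      let τ , τ<b , bnd = common-bound (regular h≡b) (λ ξ → g ξ α)
            (λ {ξ} _ → subst (λ β → ∣ g ξ α ∣ ≺ ∣ ↓ β ∣) h≡b (proj₂ (g-loc ξ α)))
      in avoid-union (b-infinite α) ν<b τ<b (λ ξ → g ξ α) bnd

    -- The number of slaloms evaded may vary with the coordinate: it is constant for lower bounds up
    -- to `κ` and diagonal for `κ⁺`. Coordinates without room take the default `bottom`.
    evade : (n : Carrier → Carrier) → ∃ λ f → f ∈ ∏b ×
            (∀ {α ξ} → Room α (n α) → ξ < n α → ¬ (f α ∈ g ξ α))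
    evade n = proj₁ ∘ choice , proj₁ ∘ proj₂ ∘ choice ,
      λ room ξ<n fα∈ → proj₂ (proj₂ (choice _)) room (_ , ξ<n , fα∈)
      where
      choice : ∀ α → ∃ λ y → y < b α × (Room α (n α) → ¬ (∃ λ ξ → ξ < n α × y ∈ g ξ α))
      choice α with em {Room α (n α)}
      ... | yes room = let y , y<b , avoids = evade-at room in y , y<b , λ _ → avoids
      ... | no ¬room = let y , y<b = bottom α in y , y<b , λ room → contradiction room ¬room

  list : {Φ : Pred Slalom ℓ} {P : Pred Carrier ℓ} → Φ ⊆ Loc → subset slalomSetoid Φ ≼ ∣ P ∣ →
    ∃ λ (g : Carrier → Slalom) → (∀ ξ → g ξ ∈ Loc) ×
      (∀ {φ} → φ ∈ Φ → ∃ λ ξ → ξ ∈ P × (∀ {α} → φ α ⊆ g ξ α))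
  list {Φ} {P} Φ⊆Loc Φ≼P = proj₁ ∘ choice , proj₁ ∘ proj₂ ∘ choice ,
    λ {φ} φ∈Φ → let ξ , ξ∈P = to (φ , φ∈Φ) in ξ , ξ∈P , proj₂ (proj₂ (choice ξ)) φ∈Φ refl
    where
    open Injection Φ≼P
    choice : ∀ ξ → ∃ λ (ψ : Slalom) → ψ ∈ Loc ×
      (∀ {φ} (φ∈Φ : φ ∈ Φ) → proj₁ (to (φ , φ∈Φ)) ≡ ξ → ∀ {α} → φ α ⊆ ψ α)
    choice ξ with em {∃ λ φ → proj₁ (to φ) ≡ ξ}
    ... | yes ((ψ , ψ∈Φ) , eq) = ψ , Φ⊆Loc ψ∈Φ ,
      λ {φ} φ∈Φ eq′ {α} → proj₁ (injective {φ , φ∈Φ} {ψ , ψ∈Φ} (trans eq′ (sym eq)) α)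
    ... | no none = (λ _ _ → ⊥) , (λ α → subsingleton-small (λ ()) (λ ())) ,
      λ φ∈Φ eq → contradiction (_ , eq) none

  ∉D⇒Room : ∀ {α μ} → ¬ (α ∈ D μ) → Room α μ
  ∉D⇒Room α∉D = ≰⇒> (λ b≤μ → α∉D (inj₁ b≤μ)) ,
                λ h≡b small → α∉D (inj₂ (h≡b , cofinality small))

  -- Past the bound of `D μ` every coordinate has room, so some `f` evades all of `Φ` from there on.
  witness-not-small : ∀ {Φ μ} → Bounded (D μ) → IsWitness Φ → ¬ (subset slalomSetoid Φ ≼ ∣ ↓ μ ∣)
  witness-not-small {μ = μ} (θ , D⊆) (Φ⊆Loc , catches) Φ≼μ =
    let g , g-loc , lists = list Φ⊆Loc Φ≼μ
        f , f∈∏b , avoids = evade g g-loc (λ _ → μ)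
        φ , φ∈Φ , f∈φ = catches f f∈∏b
        ξ , ξ<μ , φ⊆g = lists φ∈Φ
        α , θ<α , fα∈ = f∈φ θ
    in avoids (∉D⇒Room λ α∈D → <⇒≱ θ<α (inj₁ (D⊆ α∈D))) ξ<μ (φ⊆g fα∈)

  enumerateSlaloms : (O : Ordinal ℓ) (Φ : Pred Slalom ℓ) (P : Pred (Ordinal.Carrier O) ℓ) →
    ∣ P ∣ ≼ subset slalomSetoid Φ ⊎ (∃ λ ξ → ξ ∈ P × subset slalomSetoid Φ ≼ ∣ Ordinal.↓ O ξ ∣)
  enumerateSlaloms O Φ P = OrdinalProperties.enumerate O _ P em
    (lower-extensionality (suc ℓ) 0ℓ ext)

  witness-size : {P : Pred Carrier ℓ} →
    (∀ {μ} → IsCardinal μ → (∃ λ ξ → ξ ∈ P × μ ≤ ξ) → Bounded (D μ)) → ∣ P ∣ ≤𝔟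
  witness-size {P} bnd Φ wit with enumerateSlaloms κ Φ P
  ... | inj₁ P≼Φ = P≼Φ
  ... | inj₂ (ξ , ξ∈P , Φ≼ξ) =
    let μ , card , μ≤ξ , ξ≼μ = cardinality ξ
    in contradiction (≼-trans Φ≼ξ ξ≼μ) (witness-not-small (bnd card (ξ , ξ∈P , μ≤ξ)) wit)

  -- The three clauses of the theorem

  leastCofinal⇒𝔟 : ∀ λ′ → IsLeastCofinal λ′ → 𝔟≃ ∣ ↓ λ′ ∣
  leastCofinal⇒𝔟 λ′ (card , cof , minimal) =
    witness ≼-whole coveringSlalom coveringSlalom-loc (λ _ → caught) ,
    witness-size λ {μ} card-μ (ξ , ξ<λ , μ≤ξ) → ¬cofinal⇒bounded em λ cof-μ →
      <⇒≱ (≤-<-trans μ≤ξ ξ<λ) (minimal μ card-μ cof-μ)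
    where
    module _ {f} (f∈ : f ∈ ∏b) where
      -- The bound `ξ < λ′` is part of the property because `pigeonhole` does not return it.
      Caught : Carrier → Pred Carrier ℓ
      Caught ξ α = ξ < λ′ × f α ∈ coveringSlalom ξ α

      frequent : Cofinal (λ α → ∃ λ ξ → ξ < λ′ × Caught ξ α)
      frequent β with cof β
      ... | α , α∈D , β≤α with D⇒coverable α∈D
      ... | ν , ν≤λ , cov with coveringSlalom-covers cov (f∈ α)
      ... | ξ , ξ<ν , fα∈ = α , (ξ , ξ<λ , ξ<λ , fα∈) , β≤α
        where ξ<λ = <-≤-trans ξ<ν ν≤λ

      caught : ∃ λ (ξ : ∃ (↓ λ′)) → f ∈∞ coveringSlalom (proj₁ ξ)
      caught with pigeonhole Caught λ′ frequent
      -- The argument `λ′` is arbitrary: any element of the cofinal set yields `ξ < λ′`.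
      ... | ξ , cof-ξ with cof-ξ λ′
      ... | _ , (ξ<λ , _) , _ = (ξ , ξ<λ) , ∈∞-cofinal {f} {coveringSlalom ξ} λ β →
        let α , (_ , fα∈) , β≤α = cof-ξ β in α , fα∈ , β≤α

  module _ (allBounded : AllBounded) where

    κ≤𝔟 : whole ≤𝔟
    κ≤𝔟 Φ wit = ≼-trans whole≼Full (witness-size {Full} (λ card _ → allBounded _ card) Φ wit)

    continuous⇒𝔟 : ∀ {S} → IsStationary S → ContinuousOn S b → 𝔟≃ whole
    continuous⇒𝔟 {S} stationary continuous =
      witness (Identity.injection whole) constantSlalom constantSlalom-loc (λ _ → caught) , κ≤𝔟
      where
      module _ {f} (f∈ : f ∈ ∏b) where
        regressive : ∀ {γ} → γ ∈ S → IsLimit γ → ∃ λ ξ → ξ < γ × (∃ λ α → γ ≤ α × f α < b ξ)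
        regressive {γ} γ∈S lim with proj₁ (continuous γ γ∈S lim) (f∈ γ)
        ... | ξ , ξ<γ , fγ<bξ = ξ , ξ<γ , γ , inj₂ refl , fγ<bξ

        caught : ∃ λ ξ → f ∈∞ constantSlalom ξ
        caught with pressing-down (λ ξ α → f α < b ξ) stationary regressive
        ... | ξ , below-bξ with pigeonhole (λ η α → f α ≡ η) (b ξ) (λ β →
              let α , fα<bξ , β≤α = below-bξ β in α , (f α , fα<bξ , refl) , β≤α)
        ... | η , constant = η , ∈∞-cofinal {f} {constantSlalom η} λ β →
              let α , fα≡η , β≤α = constant β in α , (fα≡η , f∈ α) , β≤α

    singular⇒𝔟 : ∀ {S} → IsStationary S →
      (∀ ξ → ξ ∈ S → ∃ λ α → ξ ≤ α × h α ≡ b α × ∃ λ μ → Cf (b α) μ × μ ≤ ξ) → 𝔟≃ whole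
    singular⇒𝔟 {S} stationary singular =
      witness (Identity.injection whole) coveringSlalom coveringSlalom-loc (λ _ → caught) , κ≤𝔟
      where
      module _ {f} (f∈ : f ∈ ∏b) where
        regressive : ∀ {γ} → γ ∈ S → IsLimit γ →
          ∃ λ ξ → ξ < γ × (∃ λ α → γ ≤ α × f α ∈ coveringSlalom ξ α)
        regressive γ∈S _ with singular _ γ∈S
        ... | α , γ≤α , h≡b , μ , cf , μ≤γ
          with coveringSlalom-covers (coverable-segments h≡b cf) (f∈ α)
        ... | ξ , ξ<μ , fα∈ = ξ , <-≤-trans ξ<μ μ≤γ , α , γ≤α , fα∈

        caught : ∃ λ ξ → f ∈∞ coveringSlalom ξ
        caught with pressing-down (λ ξ α → f α ∈ coveringSlalom ξ α) stationary regressive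
        ... | ξ , cof = ξ , ∈∞-cofinal {f} {coveringSlalom ξ} cof

    -- A strict bound `α` of `D μ`, for `μ` the cardinality of `β`, lies outside `D μ`, so
    -- `μ < b α`. As `b α` is a cardinal, it then exceeds `β` too.
    b-unbounded : ∀ β → ∃ λ α → β < b α
    b-unbounded β =
      let μ , card , _ , β≼μ = cardinality β
          α , D⊆ = allBounded μ card
          μ<b , _ = ∉D⇒Room {α} {μ} λ α∈D → <-irrefl refl (D⊆ α∈D)
      in α , ≰⇒> λ b≤β → proj₁ (b-infinite α) μ μ<b (≼-trans (↓-mono b≤β) β≼μ)

    discontinuous⇒𝔟 : Increasing b → ∀ {C} → IsClub C → DiscontinuousOn C b →
      (∀ ξ → ξ ∈ C → ∀ α → ξ ≤ α → h α ≡ b α → ∃ λ μ → Cf (b α) μ × ξ < μ) →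
      ∀ {κ⁺} → IsSuccessorCardinal κ κ⁺ → Ordinal.whole κ⁺ ≤𝔟
    discontinuous⇒𝔟 b-mono {C} (C-cofinal , C-closed) discontinuous large {κ⁺} κ⁺-succ
      Φ (Φ⊆Loc , catches) with enumerateSlaloms κ⁺ Φ Full
    ... | inj₁ κ⁺≼Φ = ≼-trans whole≼Full κ⁺≼Φ
    ... | inj₂ (ζ , _ , Φ≼ζ) =
      let g , g-loc , lists = list {P = Full} Φ⊆Loc
            (≼-trans Φ≼ζ (≼-trans (below-successor emˡ extˡ {κ} {κ⁺} κ⁺-succ ζ) whole≼Full))
          f , f∈∏b , avoids = evade g g-loc (λ α → proj₁ (greatest-below E-club α))
          φ , φ∈Φ , f∈φ = catches f f∈∏b
          ξ , _ , φ⊆g = lists φ∈Φ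
          -- Past an element `γ > ξ` of `E`, the largest element of `E` up to `α` exceeds `ξ`, so
          -- coordinate `α` evades the slalom listed at `ξ`.
          ξ′ , ξ<ξ′ = above ξ
          γ , γ∈E , ξ′≤γ = proj₁ E-club ξ′
          α , γ<α , fα∈ = f∈φ γ
          δ∈E , δ≤α , γ≤δ = proj₂ (greatest-below E-club α) γ∈E (inj₁ γ<α)
      in contradiction (φ⊆g fα∈)
           (avoids (E-room δ∈E δ≤α) (<-≤-trans ξ<ξ′ (≤-trans ξ′≤γ γ≤δ)))
      where
      -- Closure under this function makes a limit `γ` both a limit of `C` and at most the union of
      -- the earlier values of `b`.
      next : ∀ β → ∃ λ γ → γ ∈ C × β < γ × β < b γ
      next β =
        let α , β<bα = b-unbounded β
            β′ , β<β′ = above β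
            δ , α≤δ , β′≤δ , _ = upperBound α β′
            γ , γ∈C , δ≤γ = C-cofinal δ
        in γ , γ∈C , <-≤-trans β<β′ (≤-trans β′≤δ δ≤γ)
             , <-≤-trans β<bα (b-mono (≤-trans α≤δ δ≤γ))

      E : Pred Carrier ℓ
      E = ClosedUnder (proj₁ ∘ next)

      E-club : IsClub E
      E-club = closedUnder-club (proj₁ ∘ next)

      E⊆C : E ⊆ C
      E⊆C (lim , closed) = C-closed _ lim λ β β<γ →
        let δ , δ∈C , β<δ , _ = next β in δ , δ∈C , inj₁ β<δ , closed β<γ

      -- If the union `σ` were below `γ`, then `next σ` would be too, and `b` would exceed `σ`
      -- there, putting `σ` into itself.
      E-below-b : ∀ {γ} → γ ∈ E → γ < b γ
      E-below-b {γ} γ∈E@(lim , closed) =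
        let σ , (_ , ⋃⊆σ) , σ<b = discontinuous γ (E⊆C γ∈E) lim
            γ≤σ = ≮⇒≥ λ σ<γ → <-irrefl refl
              (⋃⊆σ (proj₁ (next σ) , closed σ<γ , proj₂ (proj₂ (proj₂ (next σ)))))
        in ≤-<-trans γ≤σ σ<b

      E-room : ∀ {α δ} → δ ∈ E → δ ≤ α → Room α δ
      E-room {α} {δ} δ∈E δ≤α = <-≤-trans (E-below-b δ∈E) (b-mono δ≤α) ,
        λ h≡b (X , cof , X≼δ) →
          let μ , (card , _ , smallest) , δ<μ = large δ (E⊆C δ∈E) α δ≤α h≡b
          in card δ δ<μ (≼-trans (smallest X cof) X≼δ)

lemma3p35 :
    ∀ {ℓ} → ExcludedMiddle (suc ℓ) → Extensionality (suc ℓ) (suc ℓ) →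
    (κ : Ordinal ℓ) (b h : Ordinal.Carrier κ → Ordinal.Carrier κ) →
    let open Ordinal κ
        open Localisation κ b h
    in
    IsInaccessible κ →
    Increasing b → Increasing h →
    (∀ α → h α ≤ b α) →
    (∀ α → IsInfiniteCardinal (b α)) →
    (∀ α → IsCardinal (h α)) →
    (∀ α → setoid (Fin 2) ≼ ∣ ↓ (h α) ∣) →
      (∀ λ′ → IsLeastCofinal λ′ → 𝔟≃ ∣ ↓ λ′ ∣)
    × (AllBounded →
         (S : Pred Carrier ℓ) → IsStationary S →
           ContinuousOn S b
         ⊎ (∀ ξ → ξ ∈ S → ∃ λ α → ξ ≤ α × h α ≡ b α × ∃ λ μ → Cf (b α) μ × μ ≤ ξ) →
         𝔟≃ whole)
    × (AllBounded →
         (C : Pred Carrier ℓ) → IsClub C →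
         DiscontinuousOn C b →
         (∀ ξ → ξ ∈ C → ∀ α → ξ ≤ α → h α ≡ b α → ∃ λ μ → Cf (b α) μ × ξ < μ) →
         (κ⁺ : Ordinal ℓ) → IsSuccessorCardinal κ κ⁺ → Ordinal.whole κ⁺ ≤𝔟)
lemma3p35 em ext κ b h κ-inaccessible b-mono _ h≤b b-infinite _ 2≼h =
  leastCofinal⇒𝔟 ,
  (λ bounded S stationary →
    [ continuous⇒𝔟 bounded stationary , singular⇒𝔟 bounded stationary ]′) ,
  λ bounded C club discontinuous large κ⁺ →
    discontinuous⇒𝔟 bounded b-mono club discontinuous large {κ⁺}
  where open Antilocalisation em ext κ b h κ-inaccessible h≤b b-infinite 2≼h
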